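{- Let $G$ be a loopless graph. Then the following are equivalent: the neighbourhood-set system $(V(G),\mathcal{N}(G))$ is extremal; the neighbourhood-set system $(V(G),\mathcal{N}(G))$ is well-graded; $G$ is either a nonempty set of isolated vertices or a union of some disjoint half-graphs and a nonempty set of isolated vertices.
   Context: Graphs are finite, undirected, with nonempty vertex set and no multiple edges. $N_G(v)$ is the set of vertices adjacent to $v$, and $\mathcal{N}(G)=\{N_G(v):v\in V(G)\}$ (without multiplicities). An isolated vertex is a vertex of degree $0$. A set system $(X,\mathcal{F})$ is a finite set $X$ with a nonempty family $\mathcal{F}$ of distinct subsets of $X$. Its one-inclusion graph $G_{\mathcal{F}}$ has a vertex $v_A$ for each $A\in\mathcal{F}$, with an edge (directed from $v_A$ to $v_B$, labelled $b$) whenever $B=A\cup\{b\}$ for some $b\in X\setminus A$. The system is well-graded if for all $A,B\in\mathcal{F}$ the distance between $v_A$ and $v_B$ in the underlying undirected graph of $G_{\mathcal{F}}$ equals $|A\triangle B|$ (infinite distance if there is no path). $Y\subseteq X$ is shattered if $\{A\cap Y:A\in\mathcal{F}\}$ is the full power set of $Y$; it is strongly shattered if there is $T\subseteq X\setminus Y$ with $\{Z\cup T:Z\subseteq Y\}\subseteq\mathcal{F}$. The system is extremal if the shattered and strongly shattered sets coincide. The half-graph of order $n\ge 1$ is a bipartite graph with parts $\{a_1,\dots,a_n\}$ and $\{b_1,\dots,b_n\}$ such that either for all $1\le i,j\le n$, $a_i$ is adjacent to $b_j$ iff $i\le j$, or for all $1\le i,j\le n$, $a_i$ is adjacent to $b_j$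 iff $i\ge j$. A "union of disjoint half-graphs and isolated vertices" is a disjoint union, with no edges between different pieces; the half-graphs may have different orders. -}

module Defs where

open import Data.Nat using (ℕ; zero; suc; NonZero) renaming (_≤_ to _≤ᴺ_)
open import Data.Fin using (Fin; zero; suc; _≤_; _≥_)
open import Data.Fin.Subset
  using (Subset; _∈_; _∉_; _⊆_; _∪_; _∩_; _─_; ∁; ⁅_⁆; ∣_∣)
open import Data.Vec using (tabulate)
open import Data.Empty using (⊥)
open import Data.Irrelevant using ([_])
open import Data.Refinement using (Refinement-syntax; _,_; value)
open import Data.Product using (Σ; ∃; ∃-syntax; _×_; _,_; proj₁; proj₂)
open import Data.Sum using (_⊎_; inj₁; inj₂)
open import Data.Sum.Relation.Binary.Pointwise using (Pointwise; ⊎-symmetric)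
open import Function.Bundles using (_↔_; _⇔_; module Inverse)
open import Level using (0ℓ)
open import Relation.Binary.Construct.Closure.Symmetric
  using (SymClosure; symmetric)
open import Relation.Binary.Core using (Rel)
open import Relation.Binary.Definitions using (Symmetric; Irreflexive; Decidable)
open import Relation.Binary.PropositionalEquality using (_≡_; refl)
open import Relation.Nullary using (does)
open import Relation.Unary using (Pred; _≐_)

------------------------------------------------------------------------
-- Graphs

-- Loops are allowed; multiple edges are not recorded, since adjacency is
-- a relation.
record Graph (V : Set) : Set₁ where
  field
    _~_   : Rel V 0ℓ
    ~-sym : Symmetric _~_

-- Decidability of adjacency makes the neighbourhoods elements of the
-- library's type of subsets of Fin n; classically it is no restriction.
record FiniteGraph (n : ℕ) : Set₁ where
  field
    graph : Graph (Fin n)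
  open Graph graph public
  field
    _~?_ : Decidable _~_

Loopless : ∀ {V} → Graph V → Set
Loopless G = Irreflexive _≡_ (Graph._~_ G)

data Walk {V} (G : Graph V) : V → V → ℕ → Set where
  nil  : ∀ {u} → Walk G u u zero
  cons : ∀ {u v w k} → Graph._~_ G u v → Walk G v w k → Walk G u w (suc k)

-- Infinite distance is the case where no d satisfies this.
IsDistance : ∀ {V} → Graph V → V → V → ℕ → Set
IsDistance G u v d = Walk G u v d × (∀ k → Walk G u v k → d ≤ᴺ k)

record _≅_ {V W : Set} (G : Graph V) (H : Graph W) : Set where
  private
    module G = Graph G
    module H = Graph H
  field
    bijection : V ↔ W
  open Inverse bijection using (to)
  field
    adjacency : ∀ u v → (u G.~ v) ⇔ (to u H.~ to v)

------------------------------------------------------------------------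
-- Set systems

record SetSystem (n : ℕ) : Set₁ where
  field
    family   : Pred (Subset n) 0ℓ
    nonempty : ∃ family

module _ {n : ℕ} (S : SetSystem n) where
  open SetSystem S

  -- The membership proof is irrelevant, so that there is exactly one
  -- vertex for each member of the family.
  Vertex : Set
  Vertex = [ A ∈ Subset n ∣ family A ]

  vertex : ∀ {A} → family A → Vertex
  vertex {A} A∈F = A , [ A∈F ]

  LabelledEdge : Fin n → Rel Vertex 0ℓ
  LabelledEdge b u v = b ∉ value u × value v ≡ value u ∪ ⁅ b ⁆

  DirectedEdge : Rel Vertex 0ℓ
  DirectedEdge u v = ∃[ b ] LabelledEdge b u v

  oneInclusionGraph : Graph Vertex
  oneInclusionGraph = record
    { _~_   = SymClosure DirectedEdge
    ; ~-sym = symmetric DirectedEdge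
    }

  WellGraded : Set
  WellGraded = ∀ {A B} (A∈F : family A) (B∈F : family B) →
    IsDistance oneInclusionGraph (vertex A∈F) (vertex B∈F)
               ∣ (A ─ B) ∪ (B ─ A) ∣

  Shattered : Pred (Subset n) 0ℓ
  Shattered Y = (λ Z → ∃[ A ] (family A × A ∩ Y ≡ Z)) ≐ (_⊆ Y)

  StronglyShattered : Pred (Subset n) 0ℓ
  StronglyShattered Y = ∃[ T ] (T ⊆ ∁ Y × (∀ Z → Z ⊆ Y → family (Z ∪ T)))

  Extremal : Set
  Extremal = Shattered ≐ StronglyShattered

------------------------------------------------------------------------
-- The system of neighbourhood sets

neighbours : ∀ {n} → FiniteGraph n → Fin n → Subset n
neighbours G v = tabulate (λ u → does (v ~? u))
  where open FiniteGraph G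

neighbourhoodSystem : ∀ {n} .{{_ : NonZero n}} → FiniteGraph n → SetSystem n
neighbourhoodSystem {suc n} G = record
  { family   = λ A → ∃[ v ] neighbours G v ≡ A
  ; nonempty = neighbours G zero , zero , refl
  }

------------------------------------------------------------------------
-- Half-graphs, isolated vertices and disjoint unions

edgeless : (V : Set) → Graph V
edgeless V = record { _~_ = λ _ _ → ⊥ ; ~-sym = λ () }

-- aᵢ is inj₁ i and bⱼ is inj₂ j.
data BipartiteEdge {V W : Set} (R : V → W → Set) : Rel (V ⊎ W) 0ℓ where
  ab : ∀ {i j} → R i j → BipartiteEdge R (inj₁ i) (inj₂ j)
  ba : ∀ {i j} → R i j → BipartiteEdge R (inj₂ j) (inj₁ i)

bipartite : ∀ {V W} → (V → W → Set) → Graph (V ⊎ W)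
bipartite R = record
  { _~_   = BipartiteEdge R
  ; ~-sym = λ { (ab r) → ba r ; (ba r) → ab r }
  }

data Orientation : Set where
  ascending descending : Orientation

halfGraph : Orientation → (k : ℕ) .{{_ : NonZero k}} → Graph (Fin k ⊎ Fin k)
halfGraph ascending  k = bipartite {Fin k} {Fin k} _≤_
halfGraph descending k = bipartite {Fin k} {Fin k} _≥_

_⊕_ : ∀ {V W} → Graph V → Graph W → Graph (V ⊎ W)
G ⊕ H = record
  { _~_   = Pointwise (Graph._~_ G) (Graph._~_ H)
  ; ~-sym = ⊎-symmetric (Graph.~-sym G) (Graph.~-sym H)
  }

data ⨁Edge {I : Set} {V : I → Set} (G : ∀ i → Graph (V i)) : Rel (Σ I V) 0ℓ where
  within : ∀ {i x y} → Graph._~_ (G i) x y → ⨁Edge G (i , x) (i , y)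

⨁ : ∀ {I : Set} {V : I → Set} → (∀ i → Graph (V i)) → Graph (Σ I V)
⨁ G = record
  { _~_   = ⨁Edge G
  ; ~-sym = λ { (within {i} e) → within (Graph.~-sym (G i) e) }
  }

IsolatedVertices : ∀ {V} → Graph V → Set
IsolatedVertices G = ∃[ m ] (NonZero m × G ≅ edgeless (Fin m))

record HalfGraphsAndIsolatedVertices {V : Set} (G : Graph V) : Set where
  field
    count               : ℕ
    {{count-nonZero}}    : NonZero count
    order               : Fin count → ℕ
    {{order-nonZero}}    : ∀ {i} → NonZero (order i)
    orientation         : Fin count → Orientation
    isolated            : ℕ
    {{isolated-nonZero}} : NonZero isolated
    isomorphism         :
      G ≅ (⨁ (λ i → halfGraph (orientation i) (order i)) ⊕ edgeless (Fin isolated))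

module Submission where

-- Call b a label if some edge of the one-inclusion graph is labelled b.  Extremality (because {b}
-- is shattered) and well-gradedness (because a path from a neighbourhood containing b to N(b)
-- must lose b) both make every non-isolated b a label.  If N(w) = N(v) ∪ {b}, then N(b) is the
-- only neighbourhood that separates v from w, so the edges labelled w or v all have N(b) as an
-- end.  Hence every non-isolated b has exactly one neighbour w, its partner, such that N(b) ∖ {w}
-- is a neighbourhood, partnership is a fixed-point-free involution, and the neighbourhoods form
-- chains growing by one element.  A maximal chain and the chain of its partners span a half-graph.
-- Conversely, in a union of half-graphs and isolated vertices every nonempty neighbourhood A has
-- an element w such that A ∖ {w} is a neighbourhood and every neighbourhood containing w contains
-- A; removing such elements one at a time gives geodesics, and shows that a shattered set has
-- at most one element and is strongly shattered.

open import Defs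
import Data.Bool as Bool
open import Data.Empty using (⊥; ⊥-elim)
import Data.Fin as Fin
open import Data.Fin using (Fin; zero; suc; toℕ; fromℕ<; inject₁)
open import Data.Fin.Properties using (any?; _≟_; toℕ<n; toℕ-fromℕ<; toℕ-injective; toℕ-inject₁)
  renaming (<-cmp to <ᶠ-cmp; _<?_ to _<ᶠ?_; <-asym to <ᶠ-asym)
open import Data.Fin.Subset
  using (Subset; inside; outside; _∈_; _∉_; _⊆_; _∪_; _∩_; _─_; _-_; ⁅_⁆; ∣_∣; Nonempty)
  renaming (⊥ to ∅)
open import Data.Fin.Subset.Properties
open import Data.Irrelevant using ([_])
import Data.List as List
open import Data.List using (List; []; _∷_; filter; allFin)
open import Data.List.Membership.Propositional.Properties
  using (∈-filter⁺; ∈-filter⁻; ∈-allFin; ∈-lookup)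
import Data.List.Relation.Unary.All as All
open import Data.List.Relation.Unary.AllPairs using (_∷_)
open import Data.List.Relation.Unary.Any using (index)
open import Data.List.Relation.Unary.Any.Properties using (lookup-index)
open import Data.List.Relation.Unary.Unique.Propositional using (Unique)
open import Data.List.Relation.Unary.Unique.Propositional.Properties using (filter⁺; allFin⁺)
open import Data.Nat
  using (ℕ; zero; suc; pred; _+_; _∸_; _≤_; _<_; z≤n; s≤s; s≤s⁻¹; NonZero; >-nonZero; >-nonZero⁻¹; ≢-nonZero⁻¹)
open import Data.Nat.GeneralisedArithmetic using (fold; fold-+)
open import Data.Nat.Properties
  using (≤-refl; ≤-reflexive; ≤-trans; ≤-antisym; ≤-total; ≤∧≢⇒<; <⇒≤; ≮⇒≥; n≮n; n≤0⇒n≡0; n≤1+n;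
         m≤n+m; _<?_; +-suc; +-identityʳ; suc-injective; m∸n+n≡m; pred[m∸n]≡m∸[1+n];
         m<n⇒0<n∸m; m≤n⇒m∸n≡0; ∸-cancelˡ-≡)
open import Data.Product using (Σ; ∃; ∃-syntax; _×_; _,_; proj₁; proj₂; map₂)
open import Data.Refinement using (value; _,_)
open import Data.Sum using (_⊎_; inj₁; inj₂; [_,_]′)
import Data.Sum.Relation.Binary.Pointwise as Pointwise
open import Data.Vec using (_∷_; here; there)
open import Data.Vec.Properties using (lookup⇒[]=; []=⇒lookup; lookup∘tabulate; ≡-dec)
open import Function using (_∘_; flip; id)
open import Function.Bundles using (_⇔_; mk⇔; mk↔ₛ′; module Equivalence; module Inverse)
open import Function.Construct.Symmetry using (⇔-sym)
open import Function.Properties.Inverse using (↔-refl)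
open import Relation.Binary.Construct.Closure.Symmetric using (SymClosure; fwd; bwd)
open import Relation.Binary.Definitions using (tri<; tri≈; tri>)
open import Relation.Binary.PropositionalEquality
open import Relation.Nullary using (¬_; Dec; yes; no; does; contradiction; ¬?)
open import Relation.Nullary.Decidable using (_×-dec_; recompute; dec-true)

private variable
  n : ℕ

-- Adjoining an element to a subset, and enumerations of decidable predicates

∣p∪⁅x⁆∣≡1+∣p∣ : (p : Subset n) {x : Fin n} → x ∉ p → ∣ p ∪ ⁅ x ⁆ ∣ ≡ suc ∣ p ∣
∣p∪⁅x⁆∣≡1+∣p∣ (outside ∷ p) {zero}  x∉p = cong (λ q → suc ∣ q ∣) (∪-identityʳ p)
∣p∪⁅x⁆∣≡1+∣p∣ (inside  ∷ p) {zero}  x∉p = contradiction here x∉p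
∣p∪⁅x⁆∣≡1+∣p∣ (outside ∷ p) {suc x} x∉p = ∣p∪⁅x⁆∣≡1+∣p∣ p (x∉p ∘ there)
∣p∪⁅x⁆∣≡1+∣p∣ (inside  ∷ p) {suc x} x∉p = cong suc (∣p∪⁅x⁆∣≡1+∣p∣ p (x∉p ∘ there))

p∪⁅x⁆≡q : {p q : Subset n} {x : Fin n} → x ∈ q → p ⊆ q →
          (∀ {y} → y ∈ q → y ∈ p ⊎ y ≡ x) → q ≡ p ∪ ⁅ x ⁆
p∪⁅x⁆≡q {p = p} {q} {x} x∈q p⊆q q⊆ = ⊆-antisym
  (λ y∈q → x∈p∪q⁺ ([ inj₁ , (λ { refl → inj₂ (x∈⁅x⁆ x) }) ]′ (q⊆ y∈q)))
  (λ y∈∪ → [ p⊆q , (λ y∈x → subst (_∈ q) (sym (x∈⁅y⁆⇒x≡y x y∈x)) x∈q) ]′ (x∈p∪q⁻ p ⁅ x ⁆ y∈∪))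

lookup-injective : ∀ {A : Set} {xs : List A} → Unique xs →
                   ∀ i j → List.lookup xs i ≡ List.lookup xs j → i ≡ j
lookup-injective (_ ∷ _)  zero    zero    _  = refl
lookup-injective (x≢ ∷ _) zero    (suc j) eq = contradiction eq (All.lookup x≢ (∈-lookup j))
lookup-injective (x≢ ∷ _) (suc i) zero    eq = contradiction (sym eq) (All.lookup x≢ (∈-lookup i))
lookup-injective (_ ∷ u)  (suc i) (suc j) eq = cong suc (lookup-injective u i j eq)

record Enumeration (P : Fin n → Set) : Set where
  field
    size      : ℕ
    element   : Fin size → Fin n
    sound     : ∀ i → P (element i)
    injective : ∀ {i j} → element i ≡ element j → i ≡ j
    position  : ∀ {x} → P x → ∃[ i ] element i ≡ x

abstract
  enumerate : {P : Fin n → Set} → (∀ x → Dec (P x)) → Enumeration P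
  enumerate {n} P? = record
    { element   = List.lookup xs
    ; sound     = λ i → proj₂ (∈-filter⁻ P? {xs = allFin n} (∈-lookup i))
    ; injective = lookup-injective (filter⁺ P? (allFin⁺ n)) _ _
    ; position  = λ {x} Px → let x∈ = ∈-filter⁺ P? (∈-allFin x) Px in index x∈ , sym (lookup-index x∈)
    }
    where
    xs : List (Fin n)
    xs = filter P? (allFin n)

-- Neighbourhoods, covers and degrees

module _ (G : FiniteGraph n) where
  open FiniteGraph G

  ∈-neighbours⁺ : ∀ {v x} → v ~ x → x ∈ neighbours G v
  ∈-neighbours⁺ {v} {x} v~x = lookup⇒[]= x _
    (trans (lookup∘tabulate _ x) (dec-true (v ~? x) v~x))

  ∈-neighbours⁻ : ∀ {v x} → x ∈ neighbours G v → v ~ x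
  ∈-neighbours⁻ {v} {x} x∈N with v ~? x | trans (sym (lookup∘tabulate (λ u → does (v ~? u)) x)) ([]=⇒lookup x∈N)
  ... | yes v~x | _ = v~x
  ... | no  _   | ()

  NonIsolated : Fin n → Set
  NonIsolated v = ∃[ u ] v ~ u

  abstract
    nonIsolated? : ∀ v → Dec (NonIsolated v)
    nonIsolated? v = any? (v ~?_)

  -- The one-inclusion edge from N(v) to N(w) labelled b.
  record Cover (v w b : Fin n) : Set where
    field
      new   : w ~ b
      fresh : ¬ v ~ b
      mono  : ∀ {x} → v ~ x → w ~ x
      same  : ∀ {x} → w ~ x → v ~ x ⊎ x ≡ b

  neighbours-cover : ∀ {v w b} → Cover v w b →
                     b ∉ neighbours G v × neighbours G w ≡ neighbours G v ∪ ⁅ b ⁆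
  neighbours-cover c = fresh ∘ ∈-neighbours⁻ ,
    p∪⁅x⁆≡q (∈-neighbours⁺ new) (∈-neighbours⁺ ∘ mono ∘ ∈-neighbours⁻)
            ([ inj₁ ∘ ∈-neighbours⁺ , inj₂ ]′ ∘ same ∘ ∈-neighbours⁻)
    where open Cover c

  cover-neighbours : ∀ {v w b} → b ∉ neighbours G v →
                     neighbours G w ≡ neighbours G v ∪ ⁅ b ⁆ → Cover v w b
  cover-neighbours {v} {w} {b} b∉ eq = record
    { new   = ∈-neighbours⁻ (subst (b ∈_) (sym eq) (x∈p∪q⁺ (inj₂ (x∈⁅x⁆ b))))
    ; fresh = b∉ ∘ ∈-neighbours⁺
    ; mono  = λ v~x → ∈-neighbours⁻ (subst (_ ∈_) (sym eq) (x∈p∪q⁺ (inj₁ (∈-neighbours⁺ v~x))))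
    ; same  = λ w~x → [ inj₁ ∘ ∈-neighbours⁻ , inj₂ ∘ x∈⁅y⁆⇒x≡y b ]′
                (x∈p∪q⁻ _ _ (subst (_ ∈_) eq (∈-neighbours⁺ w~x)))
    }

  abstract
    degree : Fin n → ℕ
    degree v = ∣ neighbours G v ∣

    degree≤n : ∀ v → degree v ≤ n
    degree≤n v = ∣p∣≤n (neighbours G v)

    nonIsolated⇒0<degree : ∀ {v} → NonIsolated v → 0 < degree v
    nonIsolated⇒0<degree {v} (u , v~u) = subst (_≤ degree v) (∣⁅x⁆∣≡1 u)
      (p⊆q⇒∣p∣≤∣q∣ (λ x∈u → subst (_∈ neighbours G v) (sym (x∈⁅y⁆⇒x≡y u x∈u)) (∈-neighbours⁺ v~u)))

    isolated⇒degree≡0 : ∀ {v} → ¬ NonIsolated v → degree v ≡ 0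
    isolated⇒degree≡0 {v} isol = trans
      (cong ∣_∣ (Empty-unique λ (x , x∈N) → isol (x , ∈-neighbours⁻ x∈N))) (∣⊥∣≡0 n)

    degree-cover : ∀ {v w b} → Cover v w b → degree w ≡ suc (degree v)
    degree-cover c with b∉ , eq ← neighbours-cover c =
      trans (cong ∣_∣ eq) (∣p∪⁅x⁆∣≡1+∣p∣ _ b∉)

  0<degree⇒nonIsolated : ∀ {v} → 0 < degree v → NonIsolated v
  0<degree⇒nonIsolated {v} 0<d with nonIsolated? v
  ... | yes ni = ni
  ... | no ¬ni = contradiction (subst (0 <_) (isolated⇒degree≡0 ¬ni) 0<d) (n≮n 0)

  LabelsAnEdge : Fin n → Set
  LabelsAnEdge b = ∃[ v ] ∃[ w ] Cover v w b

-- Chains of neighbourhoods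

module Chains (G : FiniteGraph n) (loopless : Loopless (FiniteGraph.graph G))
              (labels : ∀ b → NonIsolated G b → LabelsAnEdge G b) where
  open FiniteGraph G
  open Cover

  private
    V = Fin n

  -- Some edge labelled `u` has ends differing in `u` alone, whereas a neighbourhood contains either
  -- both or neither of two twins.
  twins-equal : ∀ {u w} → NonIsolated G u → (∀ {x} → u ~ x → w ~ x) → (∀ {x} → w ~ x → u ~ x) → u ≡ w
  twins-equal {u} {w} ni to from with labels u ni
  ... | v′ , w′ , c with same c (~-sym (to (~-sym (new c))))
  ... | inj₁ v′~w = contradiction (~-sym (from (~-sym v′~w))) (fresh c)
  ... | inj₂ w≡u  = sym w≡u

  cover-ends-differ : ∀ {v w b} → Cover G v w b → v ≢ w
  cover-ends-differ c refl = fresh c (new c)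

  -- Take an edge labelled `w`, from N(x) up to N(y). If `y` is not `b`, then `y` is adjacent to `v`
  -- as well as to `w`, so `v` is still in N(x); but then N(v) ⊆ N(w) puts `w` into N(x) too.
  cover-swap : ∀ {v w b} → Cover G v w b → ∃[ c ] Cover G c b w
  cover-swap {v} {w} {b} c with labels w (b , new c)
  ... | x , y , c₂ with same c (~-sym (new c₂))
  ... | inj₂ refl = x , c₂
  ... | inj₁ v~y with same c₂ (~-sym v~y)
  ...   | inj₁ x~v = contradiction (~-sym (mono c (~-sym x~v))) (fresh c₂)
  ...   | inj₂ v≡w = contradiction v≡w (cover-ends-differ c)

  -- Take an edge labelled `v` with lower end N(x). Its upper end contains `w` because N(v) ⊆ N(w),
  -- and hence so does N(x), which lacks only `v`. As `b` is the only neighbour of `w` outside N(v),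
  -- `x` is `b`.
  cover-above : ∀ {v w b} → Cover G v w b → NonIsolated G v → ∃[ d ] Cover G b d v
  cover-above {v} {w} {b} c ni with labels v ni
  ... | x , y , c₂ with same c₂ (~-sym (mono c (~-sym (new c₂))))
  ... | inj₂ w≡v = contradiction (sym w≡v) (cover-ends-differ c)
  ... | inj₁ x~w with same c (~-sym x~w)
  ...   | inj₁ v~x  = contradiction (~-sym v~x) (fresh c₂)
  ...   | inj₂ refl = y , c₂

  -- Makes the partner of `b` well defined. By `cover-swap`, N(w′) = N(d) ∪ {b} for some `d`. If
  -- `w′` were in N(c), then `c` would be in N(d), and N(c) ⊆ N(b) would put `b` into N(d).
  cover-label-unique : ∀ {c c′ b w w′} → Cover G c b w → Cover G c′ b w′ → w ≡ w′
  cover-label-unique {c} {c′} {b} {w} {w′} p p′ with same p (new p′)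
  ... | inj₂ w′≡w = sym w′≡w
  ... | inj₁ c~w′ with cover-swap p′
  ...   | d , q with same q (~-sym c~w′)
  ...     | inj₁ d~c = contradiction (~-sym (mono p (~-sym d~c))) (fresh q)
  ...     | inj₂ c≡b = contradiction c≡b (cover-ends-differ p)

  cover-bottom-unique : ∀ {c c′ b w w′} → NonIsolated G c → Cover G c b w → Cover G c′ b w′ → c ≡ c′
  cover-bottom-unique ni p p′ with refl ← cover-label-unique p p′ =
    twins-equal ni (half p p′) (half p′ p)
    where
    half : ∀ {c c′ b w} → Cover G c b w → Cover G c′ b w → ∀ {x} → c ~ x → c′ ~ x
    half p p′ c~x with same p′ (mono p c~x)
    ... | inj₁ c′~x = c′~x
    ... | inj₂ refl = contradiction c~x (fresh p)

  -- By `cover-above` and the uniqueness of labels, N(x) = N(v) ∪ {b} = N(v′) ∪ {b} for one vertex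
  -- `x`, the partner of `b`. This forces `v = v′`, and then `d` and `d′` are twins.
  cover-top-unique : ∀ {b d d′ v v′} → NonIsolated G b → Cover G b d v → Cover G b d′ v′ → d ≡ d′
  cover-top-unique {b} {d} {d′} {v} {v′} ni p p′
    with x , q ← cover-above p ni | x′ , q′ ← cover-above p′ ni
    with refl ← cover-label-unique (proj₂ (cover-swap q)) (proj₂ (cover-swap q′))
    with same q (mono q′ (~-sym (new p′)))
  ... | inj₂ d′≡b = contradiction (sym d′≡b) (cover-ends-differ p′)
  ... | inj₁ v~d′ with same p′ (~-sym v~d′)
  ...   | inj₁ b~v  = contradiction b~v (fresh p)
  ...   | inj₂ refl = twins-equal (v , new p) (half p p′) (half p′ p)
    where
    half : ∀ {d d′} → Cover G b d v → Cover G b d′ v → ∀ {x} → d ~ x → d′ ~ x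
    half p p′ d~x with same p d~x
    ... | inj₁ b~x  = mono p′ b~x
    ... | inj₂ refl = new p′

  abstract
    lowerCover : ∀ v → NonIsolated G v → ∃[ c ] ∃[ w ] Cover G c v w
    lowerCover v ni with _ , w , c ← labels v ni = map₂ (w ,_) (cover-swap c)

    -- The value at isolated vertices is junk; fixing them keeps degree-down true.
    downAndPartner : V → V × V
    downAndPartner v with nonIsolated? G v
    ... | yes ni = let c , w , _ = lowerCover v ni in c , w
    ... | no  _  = v , v

    down partner : V → V
    down    = proj₁ ∘ downAndPartner
    partner = proj₂ ∘ downAndPartner

    down-cover : ∀ {v} → NonIsolated G v → Cover G (down v) v (partner v)
    down-cover {v} ni with nonIsolated? G v
    ... | yes ni′ = proj₂ (proj₂ (lowerCover v ni′))
    ... | no  ¬ni = contradiction ni ¬ni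

    down-nonIsolated⁻ : ∀ {v} → NonIsolated G (down v) → NonIsolated G v
    down-nonIsolated⁻ {v} ni with nonIsolated? G v
    ... | yes ni′ = ni′
    ... | no  _   = ni

    degree-down : ∀ v → degree G (down v) ≡ pred (degree G v)
    degree-down v with nonIsolated? G v
    ... | yes ni = sym (cong pred (degree-cover G (proj₂ (proj₂ (lowerCover v ni)))))
    ... | no ¬ni = trans (isolated⇒degree≡0 G ¬ni) (cong pred (sym (isolated⇒degree≡0 G ¬ni)))

  ~-partner : ∀ {v} → NonIsolated G v → v ~ partner v
  ~-partner = new ∘ down-cover

  partner-nonIsolated : ∀ {v} → NonIsolated G v → NonIsolated G (partner v)
  partner-nonIsolated {v} ni = v , ~-sym (~-partner ni)

  partner-unique : ∀ {c b w} → Cover G c b w → partner b ≡ w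
  partner-unique c = cover-label-unique (down-cover (_ , new c)) c

  partner-involutive : ∀ {v} → NonIsolated G v → partner (partner v) ≡ v
  partner-involutive ni = partner-unique (proj₂ (cover-swap (down-cover ni)))

  down-injective : ∀ {x y} → NonIsolated G (down x) → down x ≡ down y → x ≡ y
  down-injective {x} {y} ni eq = cover-top-unique ni
    (down-cover (down-nonIsolated⁻ ni))
    (subst (λ c → Cover G c y (partner y)) (sym eq)
           (down-cover (down-nonIsolated⁻ (subst (NonIsolated G) eq ni))))

  -- Partnership turns a chain upside down: by `cover-above`, the label `down x` leads up from
  -- `partner x`, to a vertex whose partner is `down x`.
  down-partner-down : ∀ {x} → NonIsolated G (down x) → down (partner (down x)) ≡ partner x
  down-partner-down {x} ni with d , c ← cover-above (down-cover (down-nonIsolated⁻ ni)) ni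
    with refl ← trans (sym (cong partner (partner-unique c))) (partner-involutive (_ , new c)) =
    sym (cover-bottom-unique (partner-nonIsolated (down-nonIsolated⁻ ni)) c (down-cover (_ , new c)))

  -- Descending chains

  infixl 8 _↓_
  _↓_ : V → ℕ → V
  x ↓ k = fold x down k

  ↓-+ : ∀ x k l → x ↓ (l + k) ≡ x ↓ k ↓ l
  ↓-+ x k l = fold-+ x down l

  -- Truncated subtraction is exact here, since a descent stays where it is once it reaches an
  -- isolated vertex.
  degree-↓ : ∀ x k → degree G (x ↓ k) ≡ degree G x ∸ k
  degree-↓ x zero    = refl
  degree-↓ x (suc k) = trans (degree-down (x ↓ k))
    (trans (cong pred (degree-↓ x k)) (pred[m∸n]≡m∸[1+n] _ k))

  ↓-nonIsolated⁺ : ∀ {x k} → k < degree G x → NonIsolated G (x ↓ k)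
  ↓-nonIsolated⁺ {x} {k} k<d = 0<degree⇒nonIsolated G (subst (0 <_) (sym (degree-↓ x k)) (m<n⇒0<n∸m k<d))

  ↓-nonIsolated⁻ : ∀ {x k} → NonIsolated G (x ↓ k) → k < degree G x
  ↓-nonIsolated⁻ {x} {k} ni with k <? degree G x
  ... | yes k<d = k<d
  ... | no  k≮d = contradiction
    (subst (0 <_) (trans (degree-↓ x k) (m≤n⇒m∸n≡0 (≮⇒≥ k≮d))) (nonIsolated⇒0<degree G ni)) (n≮n 0)

  ↓-mono : ∀ {x y} k → (x ↓ k) ~ y → x ~ y
  ↓-mono zero x~y = x~y
  ↓-mono {x} (suc k) dx~y = ↓-mono k (mono (down-cover (down-nonIsolated⁻ {x ↓ k} (_ , dx~y))) dx~y)

  -- Descending from `x` removes the elements of N(x) one at a time until none is left; `partner y`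
  -- is the vertex from which the step down removes `y`.
  ~⇒partner-below : ∀ {x y} → x ~ y → ∃[ k ] partner y ≡ x ↓ k
  ~⇒partner-below {x} = go (degree G x) refl
    where
    go : ∀ d {x y} → degree G x ≡ d → x ~ y → ∃[ k ] partner y ≡ x ↓ k
    go zero eq x~y = contradiction (subst (0 <_) eq (nonIsolated⇒0<degree G (_ , x~y))) (n≮n 0)
    go (suc d) {x} eq x~y with same (down-cover (_ , x~y)) x~y
    ... | inj₂ refl = 0 , partner-involutive (_ , x~y)
    ... | inj₁ dx~y with k , e ← go d (trans (degree-down x) (cong pred eq)) dx~y =
      k + 1 , trans e (sym (↓-+ x 1 k))

  partner-below⇒~ : ∀ {x y} k → NonIsolated G y → partner y ≡ x ↓ k → x ~ y
  partner-below⇒~ {y = y} k ni eq = ↓-mono k (subst (_~ y) eq (~-sym (~-partner ni)))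

  -- Tops of chains

  IsTop : V → Set
  IsTop t = ∀ d → NonIsolated G d → down d ≢ t

  private
    -- Every step up raises the degree by one, and degrees are at most `n`, so a top is met before
    -- the fuel runs out.
    findTop : ∀ fuel v → n ≤ degree G v + fuel → NonIsolated G v → ∃[ t ] IsTop t × ∃[ k ] v ≡ t ↓ k
    findTop fuel v n≤ ni with any? (λ d → nonIsolated? G d ×-dec down d ≟ v)
    ... | no  top = v , (λ d ni′ eq → top (d , ni′ , eq)) , 0 , refl
    ... | yes (d , ni′ , refl) with fuel
    ...   | zero = contradiction
      (≤-trans (≤-reflexive (sym (degree-cover G (down-cover ni′)))) (degree≤n G d))
      (λ lt → n≮n _ (≤-trans (s≤s (subst (n ≤_) (+-identityʳ _) n≤)) lt))
    ...   | suc fuel with t , top , k , refl ← findTop fuel d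
                (≤-trans n≤ (≤-reflexive (trans (+-suc _ fuel)
                  (cong (_+ fuel) (sym (degree-cover G (down-cover ni′))))))) ni′ =
      t , top , suc k , refl

    topAbove : ∀ v → NonIsolated G v → ∃[ t ] IsTop t × ∃[ k ] v ≡ t ↓ k
    topAbove v = findTop n v (m≤n+m n (degree G v))

    -- As `down` is injective where its value is not isolated, the two descents can be retraced
    -- upwards in step until one of them reaches its top.
    top-unique : ∀ {t s} j k → IsTop t → IsTop s → NonIsolated G (t ↓ j) → t ↓ j ≡ s ↓ k → t ≡ s
    top-unique zero    zero    _    _    _  eq = eq
    top-unique zero    (suc k) topt _    ni eq =
      contradiction (sym eq) (topt _ (down-nonIsolated⁻ (subst (NonIsolated G) eq ni)))
    top-unique (suc j) zero    _    tops ni eq =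
      contradiction eq (tops _ (down-nonIsolated⁻ ni))
    top-unique (suc j) (suc k) topt tops ni eq =
      top-unique j k topt tops (down-nonIsolated⁻ ni) (down-injective ni eq)

  abstract
    top : V → V
    top v with nonIsolated? G v
    ... | yes ni = proj₁ (topAbove v ni)
    ... | no  _  = v

    top-isTop : ∀ {v} → NonIsolated G v → IsTop (top v)
    top-isTop {v} ni with nonIsolated? G v
    ... | yes ni′ = proj₁ (proj₂ (topAbove v ni′))
    ... | no  ¬ni = contradiction ni ¬ni

    below-top : ∀ {v} → NonIsolated G v → ∃[ k ] v ≡ top v ↓ k
    below-top {v} ni with nonIsolated? G v
    ... | yes ni′ = proj₂ (proj₂ (topAbove v ni′))
    ... | no  ¬ni = contradiction ni ¬ni

  top-nonIsolated : ∀ {v} → NonIsolated G v → NonIsolated G (top v)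
  top-nonIsolated ni@(u , v~u) with k , eq ← below-top ni = u , ↓-mono k (subst (_~ u) eq v~u)

  top-of-below : ∀ {v t} k → NonIsolated G v → IsTop t → v ≡ t ↓ k → top v ≡ t
  top-of-below k ni topt eq with j , eq′ ← below-top ni =
    top-unique j k (top-isTop ni) topt (subst (NonIsolated G) eq′ ni) (trans (sym eq′) eq)

  top-idempotent : ∀ {v} → NonIsolated G v → top (top v) ≡ top v
  top-idempotent ni = top-of-below 0 (top-nonIsolated ni) (top-isTop ni) refl

  top-↓ : ∀ {x} k → NonIsolated G (x ↓ k) → top (x ↓ k) ≡ top x
  top-↓ {x} k ni@(u , e) with x-ni ← (u , ↓-mono k e) with j , eq ← below-top x-ni =
    top-of-below (k + j) ni (top-isTop x-ni) (trans (cong (_↓ k) eq) (sym (↓-+ (top x) j k)))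

  -- The partners of a descending chain form an ascending chain, by `down-partner-down`, and so
  -- share a top.
  top-partner-↓ : ∀ x k → NonIsolated G (x ↓ k) → top (partner (x ↓ k)) ≡ top (partner x)
  top-partner-↓ x zero    ni = refl
  top-partner-↓ x (suc k) ni = begin
    top (partner (x ↓ suc k))        ≡⟨ top-↓ 1 (subst (NonIsolated G) (sym eq) ni′) ⟨
    top (down (partner (x ↓ suc k))) ≡⟨ cong top eq ⟩
    top (partner (x ↓ k))            ≡⟨ top-partner-↓ x k (down-nonIsolated⁻ ni) ⟩
    top (partner x)                  ∎
    where
    open ≡-Reasoning
    eq = down-partner-down {x ↓ k} ni
    ni′ = partner-nonIsolated (down-nonIsolated⁻ {x ↓ k} ni)

  -- Opposite chains

  opposite : V → V
  opposite = top ∘ partner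

  opposite-top : ∀ {v} → NonIsolated G v → opposite (top v) ≡ opposite v
  opposite-top {v} ni with k , eq ← below-top ni =
    sym (trans (cong opposite eq) (top-partner-↓ (top v) k (subst (NonIsolated G) eq ni)))

  opposite-opposite : ∀ {v} → NonIsolated G v → opposite (opposite v) ≡ top v
  opposite-opposite ni =
    trans (opposite-top (partner-nonIsolated ni)) (cong top (partner-involutive ni))

  not-below-partner : ∀ {v} k → NonIsolated G v → partner v ≢ v ↓ k
  not-below-partner k ni eq = loopless refl (partner-below⇒~ k ni eq)

  -- On a common chain, one of `v` and `partner v` would be reached from the other by descending,
  -- and a vertex whose partner lies below it has a loop.
  top≢opposite : ∀ {v} → NonIsolated G v → top v ≢ opposite v
  top≢opposite {v} ni eq
    with j , v≡ ← below-top ni | k , p≡ ← below-top (partner-nonIsolated ni) with ≤-total j k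
  ... | inj₁ j≤k = not-below-partner (k ∸ j) ni (begin
      partner v              ≡⟨ p≡ ⟩
      opposite v ↓ k         ≡⟨ cong (_↓ k) eq ⟨
      top v ↓ k              ≡⟨ cong (top v ↓_) (m∸n+n≡m j≤k) ⟨
      top v ↓ (k ∸ j + j)    ≡⟨ ↓-+ (top v) j (k ∸ j) ⟩
      top v ↓ j ↓ (k ∸ j)    ≡⟨ cong (_↓ (k ∸ j)) v≡ ⟨
      v ↓ (k ∸ j)            ∎)
    where open ≡-Reasoning
  ... | inj₂ k≤j = not-below-partner (j ∸ k) (partner-nonIsolated ni) (begin
      partner (partner v)         ≡⟨ partner-involutive ni ⟩
      v                           ≡⟨ v≡ ⟩
      top v ↓ j                   ≡⟨ cong (_↓ j) eq ⟩
      opposite v ↓ j              ≡⟨ cong (opposite v ↓_) (m∸n+n≡m k≤j) ⟨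
      opposite v ↓ (j ∸ k + k)    ≡⟨ ↓-+ (opposite v) k (j ∸ k) ⟩
      opposite v ↓ k ↓ (j ∸ k)    ≡⟨ cong (_↓ (j ∸ k)) p≡ ⟨
      partner v ↓ (j ∸ k)         ∎)
    where open ≡-Reasoning

  -- Edges join opposite chains only, because `partner y` lies on the chain of `x`.
  ~⇒top≡opposite : ∀ {x y} → x ~ y → top x ≡ opposite y
  ~⇒top≡opposite {x} {y} x~y with k , eq ← ~⇒partner-below x~y =
    sym (trans (cong top eq) (top-↓ k (subst (NonIsolated G) eq (partner-nonIsolated (x , ~-sym x~y)))))

  -- Each component has two tops, opposite to each other; its representative is the smaller one.
  Representative : V → Set
  Representative t = NonIsolated G t × top t ≡ t × t Fin.< opposite t

  representative? : ∀ t → Dec (Representative t)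
  representative? t = nonIsolated? G t ×-dec top t ≟ t ×-dec t <ᶠ? opposite t

  opposite-not-representative : ∀ {t s} → Representative t → Representative s → t ≢ opposite s
  opposite-not-representative {s = s} (_ , _ , t<) (ni , eq , s<) refl =
    <ᶠ-asym {x = s} {y = opposite s} s< (subst (opposite s Fin.<_) (trans (opposite-opposite ni) eq) t<)

  -- The isomorphism with a union of half-graphs and isolated vertices

  abstract
    representatives : Enumeration Representative
    representatives = enumerate representative?

    isolatedVertices : Enumeration (λ v → ¬ NonIsolated G v)
    isolatedVertices = enumerate (λ v → ¬? (nonIsolated? G v))

  module Representatives = Enumeration representatives
  module Isolated = Enumeration isolatedVertices

  private
    rep : Fin Representatives.size → V
    rep = Representatives.element

  order : Fin Representatives.size → ℕ
  order i = degree G (rep i)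

  Index : Set
  Index = Σ (Fin Representatives.size) (λ i → Fin (order i) ⊎ Fin (order i)) ⊎ Fin Isolated.size

  -- With growing `j`, the `a i j` run down the chain of the representative while the `b i j` run up
  -- the opposite chain; this numbering gives the ascending orientation.
  a b : ∀ i → Fin (order i) → V
  a i j = rep i ↓ toℕ j
  b i j = partner (a i j)

  place : Index → V
  place (inj₁ (i , inj₁ j)) = a i j
  place (inj₁ (i , inj₂ j)) = b i j
  place (inj₂ k)            = Isolated.element k

  a-nonIsolated : ∀ i j → NonIsolated G (a i j)
  a-nonIsolated i j = ↓-nonIsolated⁺ (toℕ<n j)

  b-nonIsolated : ∀ i j → NonIsolated G (b i j)
  b-nonIsolated i j = partner-nonIsolated (a-nonIsolated i j)

  top-a : ∀ i j → top (a i j) ≡ rep i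
  top-a i j = trans (top-↓ (toℕ j) (a-nonIsolated i j)) (proj₁ (proj₂ (Representatives.sound i)))

  top-b : ∀ i j → top (b i j) ≡ opposite (rep i)
  top-b i j = top-partner-↓ (rep i) (toℕ j) (a-nonIsolated i j)

  opposite-b : ∀ i j → opposite (b i j) ≡ rep i
  opposite-b i j = trans (cong top (partner-involutive (a-nonIsolated i j))) (top-a i j)

  rep≢opposite-rep : ∀ i i′ → rep i ≢ opposite (rep i′)
  rep≢opposite-rep i i′ = opposite-not-representative (Representatives.sound i) (Representatives.sound i′)

  -- The top recovers `i`, and the degree recovers `j`.
  a-injective : ∀ {i j i′ j′} → a i j ≡ a i′ j′ → _≡_ {A = Index} (inj₁ (i , inj₁ j)) (inj₁ (i′ , inj₁ j′))
  a-injective {i} {j} {i′} {j′} eq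
    with refl ← Representatives.injective (trans (sym (top-a i j)) (trans (cong top eq) (top-a i′ j′))) =
    cong (λ j → inj₁ (i , inj₁ j)) (toℕ-injective (∸-cancelˡ-≡ (<⇒≤ (toℕ<n j)) (<⇒≤ (toℕ<n j′))
      (trans (sym (degree-↓ (rep i) (toℕ j))) (trans (cong (degree G) eq) (degree-↓ (rep i) (toℕ j′))))))

  b-injective : ∀ {i j i′ j′} → b i j ≡ b i′ j′ → _≡_ {A = Index} (inj₁ (i , inj₂ j)) (inj₁ (i′ , inj₂ j′))
  b-injective {i} {j} {i′} {j′} eq with refl ← a-injective {i} {j} {i′} {j′}
    (trans (sym (partner-involutive (a-nonIsolated i j)))
           (trans (cong partner eq) (partner-involutive (a-nonIsolated i′ j′)))) = refl

  a≢b : ∀ i j i′ j′ → a i j ≢ b i′ j′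
  a≢b i j i′ j′ eq = rep≢opposite-rep i i′ (trans (sym (top-a i j)) (trans (cong top eq) (top-b i′ j′)))

  isolated-element : ∀ {k v} → NonIsolated G v → Isolated.element k ≢ v
  isolated-element {k} ni refl = Isolated.sound k ni

  place-injective : ∀ x y → place x ≡ place y → x ≡ y
  place-injective (inj₁ (i , inj₁ j)) (inj₁ (i′ , inj₁ j′)) eq = a-injective eq
  place-injective (inj₁ (i , inj₁ j)) (inj₁ (i′ , inj₂ j′)) eq = contradiction eq (a≢b i j i′ j′)
  place-injective (inj₁ (i , inj₂ j)) (inj₁ (i′ , inj₁ j′)) eq = contradiction (sym eq) (a≢b i′ j′ i j)
  place-injective (inj₁ (i , inj₂ j)) (inj₁ (i′ , inj₂ j′)) eq = b-injective eq
  place-injective (inj₁ (i , inj₁ j)) (inj₂ k) eq = contradiction (sym eq) (isolated-element (a-nonIsolated i j))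
  place-injective (inj₁ (i , inj₂ j)) (inj₂ k) eq = contradiction (sym eq) (isolated-element (b-nonIsolated i j))
  place-injective (inj₂ k) (inj₁ (i , inj₁ j)) eq = contradiction eq (isolated-element (a-nonIsolated i j))
  place-injective (inj₂ k) (inj₁ (i , inj₂ j)) eq = contradiction eq (isolated-element (b-nonIsolated i j))
  place-injective (inj₂ k) (inj₂ k′) eq = cong inj₂ (Isolated.injective eq)

  private
    -- Covers the vertices whose own top is the smaller of the two tops of the component; the
    -- remaining non-isolated ones are found through their partners.
    locateA : ∀ {v} → NonIsolated G v → top v Fin.< opposite v → ∃[ i ] ∃[ j ] a i j ≡ v
    locateA {v} ni lt
      with k , eq ← below-top ni
      with i , refl-i ← Representatives.position
             (top-nonIsolated ni , top-idempotent ni , subst (top v Fin.<_) (sym (opposite-top ni)) lt) =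
      i , fromℕ< k<d , trans (cong (rep i ↓_) (toℕ-fromℕ< k<d)) eq′
      where
      eq′ = trans (cong (_↓ k) refl-i) (sym eq)
      k<d = ↓-nonIsolated⁻ {rep i} {k} (subst (NonIsolated G) (sym eq′) ni)

  located : ∀ v → ∃[ x ] place x ≡ v
  located v with nonIsolated? G v
  ... | no ¬ni with k , eq ← Isolated.position ¬ni = inj₂ k , eq
  ... | yes ni with <ᶠ-cmp (top v) (opposite v)
  ...   | tri< lt _ _ with i , j , eq ← locateA ni lt = inj₁ (i , inj₁ j) , eq
  ...   | tri≈ _ eq _ = contradiction eq (top≢opposite ni)
  ...   | tri> _ _ gt
    with i , j , eq ← locateA (partner-nonIsolated ni)
           (subst (opposite v Fin.<_) (sym (cong top (partner-involutive ni))) gt) =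
    inj₁ (i , inj₂ j) , trans (cong partner eq) (partner-involutive ni)

  instance
    order-nonZero : ∀ {i} → NonZero (order i)
    order-nonZero {i} = >-nonZero (nonIsolated⇒0<degree G (proj₁ (Representatives.sound i)))

  HalfGraphs : Graph Index
  HalfGraphs = ⨁ (λ i → halfGraph ascending (order i)) ⊕ edgeless (Fin Isolated.size)

  private
    module H = Graph HalfGraphs

  -- The partner of `b i j′` is `a i j′`, which lies `toℕ j′ ∸ toℕ j` steps below `a i j`.
  a~b⁺ : ∀ {i j j′} → j Fin.≤ j′ → a i j ~ b i j′
  a~b⁺ {i} {j} {j′} j≤j′ = partner-below⇒~ (toℕ j′ ∸ toℕ j) (b-nonIsolated i j′) (begin
    partner (b i j′)                       ≡⟨ partner-involutive (a-nonIsolated i j′) ⟩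
    rep i ↓ toℕ j′                         ≡⟨ cong (rep i ↓_) (m∸n+n≡m j≤j′) ⟨
    rep i ↓ (toℕ j′ ∸ toℕ j + toℕ j)       ≡⟨ ↓-+ (rep i) (toℕ j) (toℕ j′ ∸ toℕ j) ⟩
    a i j ↓ (toℕ j′ ∸ toℕ j)               ∎)
    where open ≡-Reasoning

  -- Adjacent vertices lie on opposite chains, whence `i = i′`. The edge also puts `a i j′` some `k`
  -- steps below `a i j`, and comparing degrees gives `toℕ j′ ≡ k + toℕ j`.
  a~b⁻ : ∀ {i j i′ j′} → a i j ~ b i′ j′ → inj₁ (i , inj₁ j) H.~ inj₁ (i′ , inj₂ j′)
  a~b⁻ {i} {j} {i′} {j′} e
    with refl ← Representatives.injective (trans (sym (top-a i j)) (trans (~⇒top≡opposite e) (opposite-b i′ j′)))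
    with k , eq ← ~⇒partner-below e = Pointwise.inj₁ (within (ab (≤-trans (m≤n+m (toℕ j) k) (≤-reflexive (sym j′≡)))))
    where
    below : a i j′ ≡ rep i ↓ (k + toℕ j)
    below = trans (sym (partner-involutive (a-nonIsolated i j′))) (trans eq (sym (↓-+ (rep i) (toℕ j) k)))
    j′≡ : toℕ j′ ≡ k + toℕ j
    j′≡ = ∸-cancelˡ-≡ (<⇒≤ (toℕ<n j′))
      (<⇒≤ (↓-nonIsolated⁻ {rep i} {k + toℕ j} (subst (NonIsolated G) below (a-nonIsolated i j′))))
      (trans (sym (degree-↓ (rep i) (toℕ j′))) (trans (cong (degree G) below) (degree-↓ (rep i) (k + toℕ j))))

  place-adjacency⁺ : ∀ x y → x H.~ y → place x ~ place y
  place-adjacency⁺ _ _ (Pointwise.inj₁ (within {i} (ab {j} {j′} j≤j′))) = a~b⁺ {i} {j} {j′} j≤j′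
  place-adjacency⁺ _ _ (Pointwise.inj₁ (within {i} (ba {j} {j′} j≤j′))) = ~-sym (a~b⁺ {i} {j} {j′} j≤j′)

  place-adjacency⁻ : ∀ x y → place x ~ place y → x H.~ y
  -- Adjacent vertices on the same side would make a representative the opposite of a
  -- representative.
  place-adjacency⁻ (inj₁ (i , inj₁ j)) (inj₁ (i′ , inj₁ j′)) e = contradiction
    (trans (sym (top-a i j)) (trans (~⇒top≡opposite e) (top-b i′ j′))) (rep≢opposite-rep i i′)
  place-adjacency⁻ (inj₁ (i , inj₁ j)) (inj₁ (i′ , inj₂ j′)) e = a~b⁻ e
  place-adjacency⁻ (inj₁ (i , inj₂ j)) (inj₁ (i′ , inj₁ j′)) e = H.~-sym (a~b⁻ (~-sym e))
  place-adjacency⁻ (inj₁ (i , inj₂ j)) (inj₁ (i′ , inj₂ j′)) e = contradiction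
    (trans (sym (opposite-b i′ j′)) (trans (sym (~⇒top≡opposite e)) (top-b i j))) (rep≢opposite-rep i′ i)
  place-adjacency⁻ (inj₂ k) y e = contradiction (_ , e) (Isolated.sound k)
  place-adjacency⁻ x (inj₂ k) e = contradiction (_ , ~-sym e) (Isolated.sound k)

  halfGraphs-isomorphism : graph ≅ HalfGraphs
  halfGraphs-isomorphism = record
    { bijection = mk↔ₛ′ locate place (λ x → place-injective _ x (place-locate (place x))) place-locate
    ; adjacency = λ u v → mk⇔
        (λ e → place-adjacency⁻ _ _ (subst₂ _~_ (sym (place-locate u)) (sym (place-locate v)) e))
        (λ e → subst₂ _~_ (place-locate u) (place-locate v) (place-adjacency⁺ _ _ e))
    }
    where
    locate : V → Index
    locate = proj₁ ∘ located
    place-locate : ∀ v → place (locate v) ≡ v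
    place-locate = proj₂ ∘ located

  -- The source of the isolated vertices: each step down removes one neighbour, so the chain of `v`
  -- ends in an empty neighbourhood.
  bottom-isolated : ∀ v → ¬ NonIsolated G (v ↓ degree G v)
  bottom-isolated v ni = n≮n _ (↓-nonIsolated⁻ {v} {degree G v} ni)

  halfGraphsAndIsolatedVertices : ∃ (NonIsolated G) → HalfGraphsAndIsolatedVertices graph
  halfGraphsAndIsolatedVertices (v , ni) = record
    { count            = Representatives.size
    ; count-nonZero    = nonempty someRepresentative
    ; order            = order
    ; orientation      = λ _ → ascending
    ; isolated         = Isolated.size
    ; isolated-nonZero = nonempty (proj₁ (Isolated.position (bottom-isolated v)))
    ; isomorphism      = halfGraphs-isomorphism
    }
    where
    nonempty : ∀ {k} → Fin k → NonZero k
    nonempty zero    = _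
    nonempty (suc _) = _
    someRepresentative : Fin Representatives.size
    someRepresentative with located v
    ... | inj₁ (i , _) , _  = i
    ... | inj₂ _ , eq = contradiction eq (isolated-element ni)

-- Peelable set systems

x∈p─q⇒x∉q : (p q : Subset n) {x : Fin n} → x ∈ p ─ q → x ∉ q
x∈p─q⇒x∉q (_ ∷ p) (inside  ∷ q) {zero}  ()
x∈p─q⇒x∉q (_ ∷ p) (outside ∷ q) {zero}  _          = λ ()
x∈p─q⇒x∉q (_ ∷ p) (_       ∷ q) {suc x} (there x∈) = x∈p─q⇒x∉q p q x∈ ∘ drop-there

x∈p-y⁻ : (p : Subset n) (y : Fin n) {x : Fin n} → x ∈ p - y → x ∈ p × x ≢ y
x∈p-y⁻ p y x∈ = p─q⊆p p ⁅ y ⁆ x∈ , x∉⁅y⁆⇒x≢y (x∈p─q⇒x∉q p ⁅ y ⁆ x∈)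

x∉p-x : (p : Subset n) (x : Fin n) → x ∉ p - x
x∉p-x p x x∈ = proj₂ (x∈p-y⁻ p x x∈) refl

p-x∪⁅x⁆≡p : (p : Subset n) {x : Fin n} → x ∈ p → p ≡ (p - x) ∪ ⁅ x ⁆
p-x∪⁅x⁆≡p p {x} x∈p = p∪⁅x⁆≡q x∈p (p─q⊆p p ⁅ x ⁆) split
  where
  split : ∀ {y} → y ∈ p → y ∈ p - x ⊎ y ≡ x
  split {y} y∈p with y ≟ x
  ... | yes y≡x = inj₂ y≡x
  ... | no  y≢x = inj₁ (x∈p∧x≢y⇒x∈p-y y∈p y≢x)

∣p∪⁅x⁆∣≤1+∣p∣ : (p : Subset n) (x : Fin n) → ∣ p ∪ ⁅ x ⁆ ∣ ≤ suc ∣ p ∣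
∣p∪⁅x⁆∣≤1+∣p∣ p x with x ∈? p
... | no  x∉p = ≤-reflexive (∣p∪⁅x⁆∣≡1+∣p∣ p x∉p)
... | yes x∈p = ≤-trans
  (p⊆q⇒∣p∣≤∣q∣ {p = p ∪ ⁅ x ⁆} {q = p} λ y∈ →
    [ id , (λ y∈x → subst (_∈ p) (sym (x∈⁅y⁆⇒x≡y x y∈x)) x∈p) ]′ (x∈p∪q⁻ p ⁅ x ⁆ y∈))
  (n≤1+n _)

infixl 5 _△_
_△_ : Subset n → Subset n → Subset n
p △ q = (p ─ q) ∪ (q ─ p)

x∈p△q⁻ : (p q : Subset n) {x : Fin n} → x ∈ p △ q → (x ∈ p × x ∉ q) ⊎ (x ∈ q × x ∉ p)
x∈p△q⁻ p q = [ (λ x∈ → inj₁ (p─q⊆p p q x∈ , x∈p─q⇒x∉q p q x∈))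
             , (λ x∈ → inj₂ (p─q⊆p q p x∈ , x∈p─q⇒x∉q q p x∈)) ]′ ∘ x∈p∪q⁻ (p ─ q) (q ─ p)

x∈p△q⁺ : {p q : Subset n} {x : Fin n} → (x ∈ p × x ∉ q) ⊎ (x ∈ q × x ∉ p) → x ∈ p △ q
x∈p△q⁺ (inj₁ (x∈p , x∉q)) = x∈p∪q⁺ (inj₁ (x∈p∧x∉q⇒x∈p─q x∈p x∉q))
x∈p△q⁺ (inj₂ (x∈q , x∉p)) = x∈p∪q⁺ (inj₂ (x∈p∧x∉q⇒x∈p─q x∈q x∉p))

∣p△p∣≡0 : (p : Subset n) → ∣ p △ p ∣ ≡ 0
∣p△p∣≡0 {n} p = trans (cong ∣_∣ (Empty-unique λ (x , x∈) →
  [ (λ (x∈p , x∉p) → x∉p x∈p) , (λ (x∈p , x∉p) → x∉p x∈p) ]′ (x∈p△q⁻ p p x∈))) (∣⊥∣≡0 n)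

∣△∣-comm : (p q : Subset n) → ∣ p △ q ∣ ≡ ∣ q △ p ∣
∣△∣-comm p q = cong ∣_∣ (∪-comm (p ─ q) (q ─ p))

∣p△q∣≡1+∣p-x△q∣ : (p q : Subset n) {x : Fin n} → x ∈ p → x ∉ q → ∣ p △ q ∣ ≡ suc ∣ (p - x) △ q ∣
∣p△q∣≡1+∣p-x△q∣ p q {x} x∈p x∉q = trans
  (cong ∣_∣ (p∪⁅x⁆≡q (x∈p△q⁺ (inj₁ (x∈p , x∉q))) widen narrow))
  (∣p∪⁅x⁆∣≡1+∣p∣ _ x∉)
  where
  x∉ : x ∉ (p - x) △ q
  x∉ x∈ with x∈p△q⁻ (p - x) q x∈
  ... | inj₁ (x∈p-x , _) = x∉p-x p x x∈p-x
  ... | inj₂ (x∈q , _)   = x∉q x∈q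
  widen : (p - x) △ q ⊆ p △ q
  widen {y} y∈ with x∈p△q⁻ (p - x) q y∈
  ... | inj₁ (y∈p-x , y∉q) = x∈p△q⁺ (inj₁ (proj₁ (x∈p-y⁻ p x y∈p-x) , y∉q))
  ... | inj₂ (y∈q , y∉p-x) = x∈p△q⁺ (inj₂ (y∈q ,
    λ y∈p → y∉p-x (x∈p∧x≢y⇒x∈p-y y∈p λ { refl → x∉q y∈q })))
  narrow : ∀ {y} → y ∈ p △ q → y ∈ (p - x) △ q ⊎ y ≡ x
  narrow {y} y∈ with y ≟ x | x∈p△q⁻ p q y∈
  ... | yes y≡x | _ = inj₂ y≡x
  ... | no  y≢x | inj₁ (y∈p , y∉q) = inj₁ (x∈p△q⁺ (inj₁ (x∈p∧x≢y⇒x∈p-y y∈p y≢x , y∉q)))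
  ... | no  y≢x | inj₂ (y∈q , y∉p) = inj₁ (x∈p△q⁺ (inj₂ (y∈q , λ y∈p-x → y∉p (proj₁ (x∈p-y⁻ p x y∈p-x)))))

∣△∣-step : (p p′ q : Subset n) (x : Fin n) → (∀ {y} → y ≢ x → y ∈ p ⇔ y ∈ p′) →
           ∣ p △ q ∣ ≤ suc ∣ p′ △ q ∣
∣△∣-step p p′ q x agree = ≤-trans (p⊆q⇒∣p∣≤∣q∣ {p = p △ q} {q = (p′ △ q) ∪ ⁅ x ⁆} include)
                                   (∣p∪⁅x⁆∣≤1+∣p∣ (p′ △ q) x)
  where
  open Equivalence
  include : p △ q ⊆ (p′ △ q) ∪ ⁅ x ⁆
  include {y} y∈ with y ≟ x | x∈p△q⁻ p q y∈
  ... | yes refl | _ = x∈p∪q⁺ (inj₂ (x∈⁅x⁆ x))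
  ... | no  y≢x  | inj₁ (y∈p , y∉q) = x∈p∪q⁺ (inj₁ (x∈p△q⁺ (inj₁ (to (agree y≢x) y∈p , y∉q))))
  ... | no  y≢x  | inj₂ (y∈q , y∉p) = x∈p∪q⁺ (inj₁ (x∈p△q⁺ (inj₂ (y∈q , y∉p ∘ from (agree y≢x)))))

∈-∪⁅⁆-⇔ : (p : Subset n) {x y : Fin n} → y ≢ x → y ∈ p ⇔ y ∈ p ∪ ⁅ x ⁆
∈-∪⁅⁆-⇔ p {x} y≢x = mk⇔ (λ y∈p → x∈p∪q⁺ (inj₁ y∈p))
  ([ id , (λ y∈x → contradiction (x∈⁅y⁆⇒x≡y x y∈x) y≢x) ]′ ∘ x∈p∪q⁻ p ⁅ x ⁆)

snoc : ∀ {V} {G : Graph V} {u v w k} → Walk G u v k → Graph._~_ G v w → Walk G u w (suc k)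
snoc nil        e = cons e nil
snoc (cons d p) e = cons d (snoc p e)

module _ (S : SetSystem n) where
  open SetSystem S

  -- The common source of well-gradedness and extremality. The last condition makes `A` the least
  -- member containing `w`.
  PeelableSystem : Set
  PeelableSystem = ∀ {A} → family A → Nonempty A →
    ∃[ w ] w ∈ A × family (A - w) × (∀ {B} → family B → w ∈ B → A ⊆ B)

  -- Each step changes the set by its label alone, so the step that loses `b` runs down an edge
  -- labelled `b`.
  walk-crosses : ∀ {u v k b} → Walk (oneInclusionGraph S) u v k → b ∈ value u → b ∉ value v →
                 ∃[ s ] ∃[ t ] LabelledEdge S b s t
  walk-crosses nil b∈ b∉ = contradiction b∈ b∉
  walk-crosses {u} {b = b} (cons {v = x} e p) b∈ b∉ with b ∈? value x
  ... | yes b∈x = walk-crosses p b∈x b∉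
  ... | no  b∉x with e
  ...   | fwd (c , _ , x≡) = contradiction (subst (b ∈_) (sym x≡) (x∈p∪q⁺ (inj₁ b∈))) b∉x
  ...   | bwd (c , c∉x , u≡) with x∈p∪q⁻ (value x) ⁅ c ⁆ (subst (b ∈_) u≡ b∈)
  ...     | inj₁ b∈x = contradiction b∈x b∉x
  ...     | inj₂ b∈c with refl ← x∈⁅y⁆⇒x≡y c b∈c = x , u , c∉x , u≡

  ∣△∣≤walk : ∀ {u v k} → Walk (oneInclusionGraph S) u v k → ∣ value u △ value v ∣ ≤ k
  ∣△∣≤walk {u} nil = ≤-reflexive (∣p△p∣≡0 (value u))
  ∣△∣≤walk {u} {v} (cons {v = x} e p) = ≤-trans (step e) (s≤s (∣△∣≤walk p))
    where
    step : SymClosure (DirectedEdge S) u x → ∣ value u △ value v ∣ ≤ suc ∣ value x △ value v ∣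
    step (fwd (b , _ , x≡)) = ∣△∣-step (value u) (value x) (value v) b
      (λ y≢b → subst (λ p → _ ∈ value u ⇔ _ ∈ p) (sym x≡) (∈-∪⁅⁆-⇔ (value u) y≢b))
    step (bwd (b , _ , u≡)) = ∣△∣-step (value u) (value x) (value v) b
      (λ y≢b → subst (λ p → _ ∈ p ⇔ _ ∈ value x) (sym u≡) (⇔-sym (∈-∪⁅⁆-⇔ (value x) y≢b)))

  stronglyShattered⇒shattered : ∀ {Y} → StronglyShattered S Y → Shattered S Y
  stronglyShattered⇒shattered {Y} (T , T⊆∁Y , cube) =
    (λ { (A , _ , refl) → p∩q⊆q A Y }) ,
    λ {Z} Z⊆Y → Z ∪ T , cube Z Z⊆Y , ⊆-antisym (forward Z) (λ z∈Z → x∈p∩q⁺ (x∈p∪q⁺ (inj₁ z∈Z) , Z⊆Y z∈Z))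
    where
    forward : ∀ Z → (Z ∪ T) ∩ Y ⊆ Z
    forward Z y∈ with y∈ZT , y∈Y ← x∈p∩q⁻ (Z ∪ T) Y y∈ with x∈p∪q⁻ Z T y∈ZT
    ... | inj₁ y∈Z = y∈Z
    ... | inj₂ y∈T = contradiction y∈Y (x∈∁p⇒x∉p (T⊆∁Y y∈T))

  module _ (peel : PeelableSystem) where

    private
      peel-edge : ∀ {A w} (A∈F : family A) (A-w∈F : family (A - w)) → w ∈ A →
                  LabelledEdge S w (vertex S A-w∈F) (vertex S A∈F)
      peel-edge {A} {w} _ _ w∈A = x∉p-x A w , p-x∪⁅x⁆≡p A w∈A

      nonempty-of-⊈ : ∀ {A B : Subset n} → ¬ A ⊆ B → Nonempty A
      nonempty-of-⊈ {A} A⊈B with nonempty? A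
      ... | yes ne = ne
      ... | no ¬ne = ⊥-elim (A⊈B λ x∈A → contradiction (_ , x∈A) ¬ne)

      -- If `A ⊈ B`, the element peeled from `A` is outside `B`, as otherwise `A ⊆ B`; peeling thus
      -- lowers the symmetric difference by exactly one. If `B ⊈ A`, the same is done at the other
      -- end of the walk.
      walk : ∀ d {A B} (A∈F : family A) (B∈F : family B) → ∣ A △ B ∣ ≡ d →
             Walk (oneInclusionGraph S) (vertex S A∈F) (vertex S B∈F) d
      walk-⊈ : ∀ d {A B} (A∈F : family A) (B∈F : family B) → ∣ A △ B ∣ ≡ d → ¬ A ⊆ B →
               Walk (oneInclusionGraph S) (vertex S A∈F) (vertex S B∈F) d
      walk-⊉ : ∀ d {A B} (A∈F : family A) (B∈F : family B) → ∣ A △ B ∣ ≡ d → ¬ B ⊆ A →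
               Walk (oneInclusionGraph S) (vertex S A∈F) (vertex S B∈F) d

      walk d {A} {B} A∈F B∈F eq with A ⊆? B | B ⊆? A
      ... | no A⊈B  | _       = walk-⊈ d A∈F B∈F eq A⊈B
      ... | yes _   | no B⊈A  = walk-⊉ d A∈F B∈F eq B⊈A
      ... | yes A⊆B | yes B⊆A with refl ← ⊆-antisym A⊆B B⊆A
        with refl ← trans (sym (∣p△p∣≡0 A)) eq = nil

      walk-⊈ d {A} {B} A∈F B∈F eq A⊈B
        with w , w∈A , A-w∈F , above ← peel A∈F (nonempty-of-⊈ A⊈B)
        with d | trans (sym (∣p△q∣≡1+∣p-x△q∣ A B w∈A (λ w∈B → A⊈B (above B∈F w∈B)))) eq
      ... | suc d | eq′ = cons (bwd (w , peel-edge A∈F A-w∈F w∈A)) (walk d A-w∈F B∈F (suc-injective eq′))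

      walk-⊉ d {A} {B} A∈F B∈F eq B⊈A
        with w , w∈B , B-w∈F , above ← peel B∈F (nonempty-of-⊈ B⊈A)
        with d | trans (sym (∣p△q∣≡1+∣p-x△q∣ B A w∈B (λ w∈A → B⊈A (above A∈F w∈A)))) (trans (∣△∣-comm B A) eq)
      ... | suc d | eq′ = snoc (walk d A∈F B-w∈F (trans (∣△∣-comm A (B - w)) (suc-injective eq′)))
                               (fwd (w , peel-edge B∈F B-w∈F w∈B))

    peelable⇒wellGraded : WellGraded S
    peelable⇒wellGraded A∈F B∈F = walk _ A∈F B∈F refl , λ k → ∣△∣≤walk

    private
      -- The element peeled from `C` is not `x`, since otherwise `C ⊆ A` and `y` would be in `A`;
      -- likewise it is not `y`. So `C` could be shrunk forever while keeping both.
      no-shattered-pair : ∀ d {A B C x y} → ∣ C ∣ ≤ d → family A → family B → family C →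
        x ∈ A → y ∉ A → y ∈ B → x ∉ B → x ∈ C → y ∈ C → ⊥
      no-shattered-pair d {A} {B} {C} {x} {y} ∣C∣≤d A∈F B∈F C∈F x∈A y∉A y∈B x∉B x∈C y∈C
        with w , w∈C , C-w∈F , above ← peel C∈F (x , x∈C) with d
      ... | zero  = n≮n 0 (≤-trans (≤-trans (s≤s z≤n) (x∈p⇒∣p-x∣<∣p∣ w∈C)) ∣C∣≤d)
      ... | suc d = no-shattered-pair d (s≤s⁻¹ (≤-trans (x∈p⇒∣p-x∣<∣p∣ w∈C) ∣C∣≤d)) A∈F B∈F C-w∈F x∈A y∉A y∈B x∉B
        (x∈p∧x≢y⇒x∈p-y x∈C λ { refl → y∉A (above A∈F x∈A y∈C) })
        (x∈p∧x≢y⇒x∈p-y y∈C λ { refl → x∉B (above B∈F y∈B x∈C) })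

      -- Other elements are peeled off until `x` itself is the one to go; `T` is what remains after
      -- that.
      strip-to : ∀ d {A x} → ∣ A ∣ ≤ d → family A → x ∈ A →
                 ∃[ T ] x ∉ T × family T × family (T ∪ ⁅ x ⁆)
      strip-to d {A} {x} ∣A∣≤d A∈F x∈A
        with w , w∈A , A-w∈F , above ← peel A∈F (x , x∈A) with x ≟ w | d
      ... | yes refl | _ = A - x , x∉p-x A x , A-w∈F , subst family (p-x∪⁅x⁆≡p A x∈A) A∈F
      ... | no  x≢w  | zero  = contradiction (≤-trans (≤-trans (s≤s z≤n) (x∈p⇒∣p-x∣<∣p∣ w∈A)) ∣A∣≤d) (n≮n 0)
      ... | no  x≢w  | suc d = strip-to d (s≤s⁻¹ (≤-trans (x∈p⇒∣p-x∣<∣p∣ w∈A) ∣A∣≤d)) A-w∈F (x∈p∧x≢y⇒x∈p-y x∈A x≢w)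

    shattered⇒stronglyShattered : ∀ {Y} → Shattered S Y → StronglyShattered S Y
    shattered⇒stronglyShattered {Y} (_ , trace) with nonempty? Y
    ... | no Y-empty with A , A∈F ← nonempty =
      -- Over the empty set the cube is a single member, and any member of the family will do.
      A , (λ {x} _ → x∉p⇒x∈∁p λ x∈Y → Y-empty (x , x∈Y)) ,
      λ Z Z⊆Y → subst family (sym (trans
        (cong (_∪ A) (Empty-unique λ (z , z∈Z) → Y-empty (z , Z⊆Y z∈Z))) (∪-identityˡ A))) A∈F
    ... | yes (x , x∈Y) with any? (λ y → y ∈? Y ×-dec ¬? (y ≟ x))
    ...   | yes (y , y∈Y , y≢x)
      with A , A∈F , A∩Y≡x ← trace {⁅ x ⁆} (λ z∈ → subst (_∈ Y) (sym (x∈⁅y⁆⇒x≡y x z∈)) x∈Y)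
         | B , B∈F , B∩Y≡y ← trace {⁅ y ⁆} (λ z∈ → subst (_∈ Y) (sym (x∈⁅y⁆⇒x≡y y z∈)) y∈Y)
         | C , C∈F , C∩Y≡Y ← trace {Y} id =
      ⊥-elim (no-shattered-pair ∣ C ∣ ≤-refl A∈F B∈F C∈F
        (in-trace A∩Y≡x (x∈⁅x⁆ x)) (λ y∈A → y≢x (x∈⁅y⁆⇒x≡y x (subst (y ∈_) A∩Y≡x (x∈p∩q⁺ (y∈A , y∈Y)))))
        (in-trace B∩Y≡y (x∈⁅x⁆ y)) (λ x∈B → y≢x (sym (x∈⁅y⁆⇒x≡y y (subst (x ∈_) B∩Y≡y (x∈p∩q⁺ (x∈B , x∈Y))))))
        (in-trace C∩Y≡Y x∈Y) (in-trace C∩Y≡Y y∈Y))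
      where
      in-trace : ∀ {A Z z} → A ∩ Y ≡ Z → z ∈ Z → z ∈ A
      in-trace {A} eq z∈Z = p∩q⊆p A Y (subst (_ ∈_) (sym eq) z∈Z)
    -- Now `Y` is `{x}`, so the cube consists of `T` and `T ∪ ⁅ x ⁆`.
    ...   | no only-x
      with A , A∈F , A∩Y≡Y ← trace {Y} id
      with T , x∉T , T∈F , T∪x∈F ← strip-to ∣ A ∣ ≤-refl A∈F (p∩q⊆p A Y (subst (x ∈_) (sym A∩Y≡Y) x∈Y)) =
      T , (λ t∈T → x∉p⇒x∈∁p λ t∈Y → x∉T (subst (_∈ T) (Y⊆x t∈Y) t∈T)) , cube
      where
      Y⊆x : ∀ {y} → y ∈ Y → y ≡ x
      Y⊆x {y} y∈Y with y ≟ x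
      ... | yes y≡x = y≡x
      ... | no  y≢x = contradiction (y , y∈Y , y≢x) only-x
      cube : ∀ Z → Z ⊆ Y → family (Z ∪ T)
      cube Z Z⊆Y with x ∈? Z
      ... | yes x∈Z = subst family (trans (cong (T ∪_) (⊆-antisym
              (λ z∈x → subst (_∈ Z) (sym (x∈⁅y⁆⇒x≡y x z∈x)) x∈Z)
              (λ z∈Z → subst (_∈ ⁅ x ⁆) (sym (Y⊆x (Z⊆Y z∈Z))) (x∈⁅x⁆ x)))) (∪-comm T Z)) T∪x∈F
      ... | no  x∉Z = subst family (sym (trans (cong (_∪ T) (Empty-unique λ (z , z∈Z) →
              x∉Z (subst (_∈ Z) (Y⊆x (Z⊆Y z∈Z)) z∈Z))) (∪-identityˡ T))) T∈F

    peelable⇒extremal : Extremal S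
    peelable⇒extremal = shattered⇒stronglyShattered , stronglyShattered⇒shattered

-- Peelable graphs

-- PeelableSystem for the neighbourhoods, with N(v′) = N(v) ∖ {w}.
PeelableVertex : ∀ {V} → Graph V → V → Set
PeelableVertex G v = ∃[ w ] v ~ w × (∃[ v′ ] ∀ x → v′ ~ x ⇔ (v ~ x × x ≢ w))
                                  × (∀ {u x} → u ~ w → v ~ x → u ~ x)
  where open Graph G

PeelableGraph : ∀ {V} → Graph V → Set
PeelableGraph G = ∀ {v u} → Graph._~_ G v u → PeelableVertex G v

≅-peelable : ∀ {V W} {G : Graph V} {H : Graph W} → G ≅ H → PeelableGraph H → PeelableGraph G
≅-peelable {V} {W} {G} {H} iso peel {v} {u} v~u
  with w , v~w , (v′ , reduced) , above ← peel (Equivalence.to (_≅_.adjacency iso v u) v~u) =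
  from w , adj⁻ (subst (to v H.~_) (sym (to-from w)) v~w) ,
  (from v′ , λ x → mk⇔
    (λ v′~x → let e , x≢w = E.to (reduced (to x)) (subst (H._~ to x) (to-from v′) (adj⁺ v′~x)) in
      adj⁻ e , λ { refl → x≢w (to-from w) })
    (λ (v~x , x≢w) → adj⁻ (subst (H._~ to x) (sym (to-from v′))
      (E.from (reduced (to x)) (adj⁺ v~x , λ { refl → x≢w (sym (from-to x)) }))))) ,
  (λ {u} u~w v~x → adj⁻ (above (subst (to u H.~_) (to-from w) (adj⁺ u~w)) (adj⁺ v~x)))
  where
  module G = Graph G
  module H = Graph H
  module E = Equivalence
  open _≅_ iso
  open Inverse bijection using (to; from; strictlyInverseˡ; strictlyInverseʳ)
  to-from : ∀ y → to (from y) ≡ y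
  to-from = strictlyInverseˡ
  from-to : ∀ x → from (to x) ≡ x
  from-to = strictlyInverseʳ
  adj⁺ : ∀ {x y} → x G.~ y → to x H.~ to y
  adj⁺ = E.to (adjacency _ _)
  adj⁻ : ∀ {x y} → to x H.~ to y → x G.~ y
  adj⁻ = E.from (adjacency _ _)

-- Inside a half-graph ∅ is not a neighbourhood, whence the alternative N(v) = {w}.
LocallyPeelable : ∀ {V} → Graph V → V → Set
LocallyPeelable G v = ∃[ w ] v ~ w × ((∃[ v′ ] ∀ x → v′ ~ x ⇔ (v ~ x × x ≢ w)) ⊎ (∀ x → v ~ x → x ≡ w))
                                   × (∀ {u x} → u ~ w → v ~ x → u ~ x)
  where open Graph G

-- Read for a partial order `R`: the principal up-set of `i` without `i` itself is again principal,
-- or empty.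
Discrete : {V : Set} → (V → V → Set) → Set
Discrete R = ∀ i → (∃[ i′ ] ∀ x → R i′ x ⇔ (R i x × x ≢ i)) ⊎ (∀ x → R i x → x ≡ i)

-- The vertex peeled from the neighbourhood of `inj₁ i` is `inj₂ i`. Its neighbours are the `inj₁ k`
-- with `R k i`, and by transitivity these are adjacent to everything `inj₁ i` is adjacent to. The
-- other side is the same for the converse relation.
bipartite-peelable : {V : Set} {R : V → V → Set} → (∀ i → R i i) → (∀ {i j k} → R i j → R j k → R i k) →
                     Discrete R → Discrete (flip R) → ∀ v → LocallyPeelable (bipartite R) v
bipartite-peelable {V} {R} R-refl R-trans next prev (inj₁ i) =
  inj₂ i , ab (R-refl i) , reduced (next i) , λ { (ab r) (ab s) → ab (R-trans r s) }
  where
  open Equivalence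
  reduced : (∃[ i′ ] ∀ x → R i′ x ⇔ (R i x × x ≢ i)) ⊎ (∀ x → R i x → x ≡ i) → _
  reduced (inj₁ (i′ , eq)) = inj₁ (inj₁ i′ , λ x → mk⇔
    (λ { (ab r) → ab (proj₁ (to (eq _) r)) , λ { refl → proj₂ (to (eq _) r) refl } })
    (λ { (ab r , x≢) → ab (from (eq _) (r , λ { refl → x≢ refl })) }))
  reduced (inj₂ only) = inj₂ λ { _ (ab r) → cong inj₂ (only _ r) }
bipartite-peelable {V} {R} R-refl R-trans next prev (inj₂ j) =
  inj₁ j , ba (R-refl j) , reduced (prev j) , λ { (ba r) (ba s) → ba (R-trans s r) }
  where
  open Equivalence
  reduced : (∃[ j′ ] ∀ x → R x j′ ⇔ (R x j × x ≢ j)) ⊎ (∀ x → R x j → x ≡ j) → _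
  reduced (inj₁ (j′ , eq)) = inj₁ (inj₂ j′ , λ x → mk⇔
    (λ { (ba r) → ba (proj₁ (to (eq _) r)) , λ { refl → proj₂ (to (eq _) r) refl } })
    (λ { (ba r , x≢) → ba (from (eq _) (r , λ { refl → x≢ refl })) }))
  reduced (inj₂ only) = inj₂ λ { _ (ba r) → cong inj₁ (only _ r) }

-- The witness is the successor of `i`; at the last index nothing but `i` lies above. For
-- `≥-discrete` it is the predecessor.
≤-discrete : ∀ {k} → Discrete {Fin k} Fin._≤_
≤-discrete {k} i with suc (toℕ i) <? k
... | yes i+1<k = inj₁ (fromℕ< i+1<k , λ x → mk⇔
        (λ le → let i<x = subst (_≤ toℕ x) (toℕ-fromℕ< i+1<k) le in <⇒≤ i<x , λ { refl → n≮n _ i<x })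
        (λ (i≤x , x≢i) → subst (_≤ toℕ x) (sym (toℕ-fromℕ< i+1<k)) (≤∧≢⇒< i≤x (x≢i ∘ sym ∘ toℕ-injective))))
... | no i+1≮k = inj₂ λ x i≤x → toℕ-injective (≤-antisym (s≤s⁻¹ (≤-trans (toℕ<n x) (≮⇒≥ i+1≮k))) i≤x)

≥-discrete : ∀ {k} → Discrete {Fin k} Fin._≥_
≥-discrete zero    = inj₂ λ x x≤0 → toℕ-injective (n≤0⇒n≡0 x≤0)
≥-discrete (suc i) = inj₁ (inject₁ i , λ x → mk⇔
  (λ le → let x≤i = subst (toℕ x ≤_) (toℕ-inject₁ i) le in
    ≤-trans x≤i (n≤1+n _) , λ { refl → n≮n _ x≤i })
  (λ (x≤ , x≢) → subst (toℕ x ≤_) (sym (toℕ-inject₁ i)) (s≤s⁻¹ (≤∧≢⇒< x≤ (x≢ ∘ toℕ-injective)))))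

halfGraph-peelable : ∀ o k .{{_ : NonZero k}} v → LocallyPeelable (halfGraph o k) v
halfGraph-peelable ascending  k = bipartite-peelable (λ _ → ≤-refl) ≤-trans ≤-discrete ≥-discrete
halfGraph-peelable descending k = bipartite-peelable (λ _ → ≤-refl) (flip ≤-trans) ≥-discrete ≤-discrete

-- Where a half-graph vertex has the single neighbour `w`, peeling leaves the empty set, which is
-- the neighbourhood of an isolated vertex. This is where the isolated part has to be nonempty.
union-peelable : ∀ {I W : Set} {V : I → Set} {G : ∀ i → Graph (V i)} → W →
                 (∀ i v → LocallyPeelable (G i) v) → PeelableGraph (⨁ G ⊕ edgeless W)
union-peelable {I} {W} {V} {G} isolated peel {inj₁ (i , v)} _ with w , v~w , reduced , above ← peel i v =
  inj₁ (i , w) , Pointwise.inj₁ (within v~w) , lift reduced ,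
  λ { (Pointwise.inj₁ (within e)) (Pointwise.inj₁ (within f)) → Pointwise.inj₁ (within (above e f)) }
  where
  open Equivalence
  open Graph (⨁ G ⊕ edgeless W)
  module Gᵢ = Graph (G i)
  lift : (∃[ v′ ] ∀ x → v′ Gᵢ.~ x ⇔ (v Gᵢ.~ x × x ≢ w)) ⊎ (∀ x → v Gᵢ.~ x → x ≡ w) →
         ∃[ v′ ] ∀ x → v′ ~ x ⇔ (inj₁ (i , v) ~ x × x ≢ inj₁ (i , w))
  lift (inj₁ (v′ , eq)) = inj₁ (i , v′) , λ x → mk⇔
    (λ { (Pointwise.inj₁ (within e)) →
           Pointwise.inj₁ (within (proj₁ (to (eq _) e))) , λ { refl → proj₂ (to (eq _) e) refl } })
    (λ { (Pointwise.inj₁ (within e) , x≢) → Pointwise.inj₁ (within (from (eq _) (e , λ { refl → x≢ refl }))) })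
  lift (inj₂ only) = inj₂ isolated , λ x → mk⇔
    (λ { (Pointwise.inj₂ ()) })
    (λ { (Pointwise.inj₁ (within e) , x≢) → contradiction (cong (λ z → inj₁ (i , z)) (only _ e)) x≢ })
union-peelable _ _ {inj₂ _} (Pointwise.inj₂ ())

-- Neighbourhood systems and the equivalences

module _ (G : FiniteGraph (suc n)) where
  open FiniteGraph G

  private
    S = neighbourhoodSystem G

  family? : ∀ A → Dec (SetSystem.family S A)
  family? A = any? (λ v → ≡-dec Bool._≟_ (neighbours G v) A)

  peelableSystem : PeelableGraph graph → PeelableSystem S
  peelableSystem peel (v , refl) (u , u∈) with w , v~w , (v′ , reduced) , above ← peel (∈-neighbours⁻ G u∈) =
    w , ∈-neighbours⁺ G v~w ,
    (v′ , ⊆-antisym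
      (λ x∈ → let v~x , x≢w = to (reduced _) (∈-neighbours⁻ G x∈) in x∈p∧x≢y⇒x∈p-y (∈-neighbours⁺ G v~x) x≢w)
      (λ x∈ → let x∈N , x≢w = x∈p-y⁻ _ w x∈ in ∈-neighbours⁺ G (from (reduced _) (∈-neighbours⁻ G x∈N , x≢w)))) ,
    λ { (u , refl) w∈ x∈ → ∈-neighbours⁺ G (above (∈-neighbours⁻ G w∈) (∈-neighbours⁻ G x∈)) }
    where open Equivalence

  module _ (loopless : Loopless graph) where

    wellGraded⇒labels : WellGraded S → ∀ b → NonIsolated G b → LabelsAnEdge G b
    wellGraded⇒labels wg b (u , b~u)
      with (s , [ s∈F ]) , (t , [ t∈F ]) , b∉s , t≡ ← walk-crosses S (proj₁ (wg (u , refl) (b , refl)))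
             (∈-neighbours⁺ G (~-sym b~u)) (loopless refl ∘ ∈-neighbours⁻ G)
      -- The ends of the edge carry only irrelevant membership proofs; decidability of membership
      -- recovers graph vertices with these neighbourhoods.
      with v , refl ← recompute (family? s) s∈F | w , refl ← recompute (family? t) t∈F =
      v , w , cover-neighbours G b∉s t≡

    -- N(u) contains `b`, and N(b) does not, as there are no loops.
    nonIsolated⇒shattered : ∀ {b} → NonIsolated G b → Shattered S ⁅ b ⁆
    nonIsolated⇒shattered {b} (u , b~u) = (λ { (A , _ , refl) → p∩q⊆q A ⁅ b ⁆ }) , trace
      where
      trace : ∀ {Z} → Z ⊆ ⁅ b ⁆ → ∃[ A ] (SetSystem.family S A × A ∩ ⁅ b ⁆ ≡ Z)
      trace {Z} Z⊆b with b ∈? Z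
      ... | yes b∈Z = neighbours G u , (u , refl) , ⊆-antisym
        (λ x∈ → subst (_∈ Z) (sym (x∈⁅y⁆⇒x≡y b (p∩q⊆q (neighbours G u) ⁅ b ⁆ x∈))) b∈Z)
        (λ x∈Z → x∈p∩q⁺
          (subst (_∈ neighbours G u) (sym (x∈⁅y⁆⇒x≡y b (Z⊆b x∈Z))) (∈-neighbours⁺ G (~-sym b~u)) , Z⊆b x∈Z))
      ... | no  b∉Z = neighbours G b , (b , refl) , ⊆-antisym
        (λ x∈ → let x∈N , x∈b = x∈p∩q⁻ (neighbours G b) ⁅ b ⁆ x∈ in
          contradiction (∈-neighbours⁻ G x∈N) (loopless (sym (x∈⁅y⁆⇒x≡y b x∈b))))
        (λ x∈Z → contradiction (subst (_∈ Z) (x∈⁅y⁆⇒x≡y b (Z⊆b x∈Z)) x∈Z) b∉Z)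

    -- A cube over the singleton `⁅ b ⁆` is exactly an edge labelled `b`, from `T` to `⁅ b ⁆ ∪ T`.
    extremal⇒labels : Extremal S → ∀ b → NonIsolated G b → LabelsAnEdge G b
    extremal⇒labels (strong , _) b ni
      with T , T⊆ , cube ← strong (nonIsolated⇒shattered ni)
      with v , v≡ ← cube ∅ (⊆-min ⁅ b ⁆) | w , w≡ ← cube ⁅ b ⁆ id =
      v , w , cover-neighbours G (λ b∈ → x∈∁p⇒x∉p (T⊆ (subst (b ∈_) v≡T b∈)) (x∈⁅x⁆ b))
        (trans w≡ (trans (∪-comm ⁅ b ⁆ T) (cong (_∪ ⁅ b ⁆) (sym v≡T))))
      where v≡T = trans v≡ (∪-identityˡ T)

    classification : (∀ b → NonIsolated G b → LabelsAnEdge G b) →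
                     IsolatedVertices graph ⊎ HalfGraphsAndIsolatedVertices graph
    classification labels with any? (nonIsolated? G)
    ... | yes ∃ni = inj₂ (Chains.halfGraphsAndIsolatedVertices G loopless labels ∃ni)
    ... | no ¬∃ni = inj₁ (suc n , _ , record
      { bijection = ↔-refl
      ; adjacency = λ u v → mk⇔ (λ e → ¬∃ni (u , v , e)) ⊥-elim
      })

  classified⇒peelable : IsolatedVertices graph ⊎ HalfGraphsAndIsolatedVertices graph → PeelableGraph graph
  classified⇒peelable (inj₁ (_ , _ , iso)) = ≅-peelable iso λ ()
  classified⇒peelable (inj₂ H) = ≅-peelable isomorphism
    (union-peelable (fromℕ< (>-nonZero⁻¹ isolated)) λ i → halfGraph-peelable (orientation i) (order i))
    where open HalfGraphsAndIsolatedVertices H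

corollary5p8 : (n : ℕ) .{{_ : NonZero n}} (G : FiniteGraph n) →
    Loopless (FiniteGraph.graph G) →
    (Extremal (neighbourhoodSystem G) ⇔ WellGraded (neighbourhoodSystem G))
    × (WellGraded (neighbourhoodSystem G)
    ⇔ (IsolatedVertices (FiniteGraph.graph G)
    ⊎ HalfGraphsAndIsolatedVertices (FiniteGraph.graph G)))
corollary5p8 zero = contradiction refl (≢-nonZero⁻¹ 0)
corollary5p8 (suc n) G loopless =
  -- Either property provides the labels and hence the classification; peelability then returns the
  -- other property.
  mk⇔ {A = Extremal S} {B = WellGraded S}
      (λ ext → peelable⇒wellGraded S (peel (classify (extremal⇒labels G loopless ext))))
      (λ wg → peelable⇒extremal S (peel (classify (wellGraded⇒labels G loopless wg)))) ,
  mk⇔ {A = WellGraded S}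
      (λ wg → classify (wellGraded⇒labels G loopless wg))
      (λ classified → peelable⇒wellGraded S (peel classified))
  where
  S = neighbourhoodSystem G
  classify = classification G loopless
  peel : IsolatedVertices (FiniteGraph.graph G) ⊎ HalfGraphsAndIsolatedVertices (FiniteGraph.graph G) →
         PeelableSystem S
  peel = peelableSystem G ∘ classified⇒peelable G
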